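{- The element $g_{ -1}(x):=x-2$ lies in $\mathcal{F}_{ -1}$ and is invertible in $\mathbb{K}[[x]]$, and the $\mathbb{Z}$-graded algebra $\mathcal{F}=\bigoplus_{r\in\mathbb{Z}}\mathcal{F}_r$ is isomorphic to the algebra $\mathcal{F}_0[T,T^{ -1}]$ of Laurent polynomials in a variable $T$ of degree $-1$ with coefficients in $\mathcal{F}_0$, via the map sending $\rho\,T^{j}$ ($\rho\in\mathcal{F}_0$, $j\in\mathbb{Z}$) to $\rho(x)(x-2)^{j}\in\mathcal{F}_{ -j}$.
   Context: $\mathbb{K}$ is one of $\mathbb{Q},\mathbb{R},\mathbb{C}$. For $r\in\mathbb{Z}$, $\mathcal{F}_r\subset\mathbb{K}[[x]]$ is the space of formal power series $\varphi$ with $\varphi(x/(x-1))=(1-x)^r\varphi(x)$. $\mathcal{F}=\bigoplus_r\mathcal{F}_r$ is the $\mathbb{Z}$-graded algebra with homogeneous components $\mathcal{F}_r$ and multiplication given on homogeneous elements by the Cauchy product (which maps $\mathcal{F}_r\times\mathcal{F}_s$ into $\mathcal{F}_{r+s}$). -}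

module Defs where

open import Level using (Level; _⊔_; suc)
open import Algebra.Bundles using (RawRing; CommutativeRing)
open import Algebra.Apartness.Bundles using (HeytingCommutativeRing; HeytingField)
import Algebra.Construct.Pointwise as Pointwise
import Algebra.Definitions as Definitions
import Algebra.Definitions.RawMonoid as RawMonoidDefinitions
open import Algebra.Module.Structures using (IsLeftModule)
import Algebra.Morphism.RingMonomorphism as RingMonomorphism
open import Algebra.Morphism.Structures using (IsRingMonomorphism; IsRingIsomorphism)
import Algebra.Properties.CommutativeSemigroup as CommutativeSemigroupProperties
import Algebra.Properties.Ring as RingProperties
import Algebra.Properties.Semiring.Exp as SemiringExp
import Algebra.Properties.Semiring.Sum as SemiringSum
open import Data.Fin.Base using (Fin; toℕ)
import Data.Fin.Properties as Fin
open import Data.Integer.Base as ℤ using (ℤ; +_; -[1+_]; 0ℤ; -1ℤ)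
import Data.Integer.Properties as ℤ
open import Data.Nat.Base as ℕ using (ℕ; zero; suc; _∸_; z≤n; s≤s)
import Data.Nat.Properties as ℕ
open import Data.Product.Base using (Σ; _,_; proj₁; proj₂)
open import Data.Unit.Polymorphic.Base using (⊤; tt)
open import Function.Base using (id)
open import Function.Bundles using (_⇔_)
open import Relation.Binary.Core using (Rel)
open import Relation.Binary.Definitions using (_Respects_)
import Relation.Binary.PropositionalEquality.Core as ≡
open ≡ using (_≡_; _≢_)
import Relation.Binary.Reasoning.Setoid as SetoidReasoning
open import Relation.Nullary.Decidable.Core using (yes; no)
open import Relation.Nullary.Negation.Core using (contradiction)
open import Relation.Unary using (Pred)

baseRing : ∀ {c ℓ₁ ℓ₂} → HeytingField c ℓ₁ ℓ₂ → CommutativeRing c ℓ₁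
baseRing K = HeytingCommutativeRing.commutativeRing (HeytingField.heytingCommutativeRing K)

-- The base field is an arbitrary (constructive) field in which every positive
-- multiple of 1 is apart from 0; ℚ, ℝ and ℂ are instances.
CharacteristicZero : ∀ {c ℓ₁ ℓ₂} → HeytingField c ℓ₁ ℓ₂ → Set ℓ₂
CharacteristicZero K = ∀ n → (ℕ.suc n × 1#) # 0#
  where
  open HeytingField K
  open RawMonoidDefinitions (CommutativeRing.+-rawMonoid (baseRing K)) using (_×_)

module IntegerPower {a ℓ} (R : CommutativeRing a ℓ) where
  open CommutativeRing R
  open Definitions _≈_ using (Invertible)
  open SemiringExp semiring using (_^_; ^-homo-*)
  open CommutativeSemigroupProperties *-commutativeSemigroup using (interchange)
  open SetoidReasoning setoid

  power : (u : Carrier) → Invertible 1# _*_ u → ℤ → Carrier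
  power u _         (+ n)    = u ^ n
  power u (u⁻¹ , _) -[1+ n ] = u⁻¹ ^ ℕ.suc n

  module _ (u : Carrier) (inv : Invertible 1# _*_ u) where
    private
      v : Carrier
      v = proj₁ inv

    power-⊖ : ∀ m n → power u inv (m ℤ.⊖ n) ≈ u ^ m * v ^ n
    power-⊖ zero    zero    = sym (*-identityˡ _)
    power-⊖ zero    (suc n) = sym (*-identityˡ _)
    power-⊖ (suc m) zero    = sym (*-identityʳ _)
    power-⊖ (suc m) (suc n) = begin
      power u inv (ℕ.suc m ℤ.⊖ ℕ.suc n)  ≡⟨ ≡.cong (power u inv) (ℤ.[1+m]⊖[1+n]≡m⊖n m n) ⟩
      power u inv (m ℤ.⊖ n)              ≈⟨ power-⊖ m n ⟩
      u ^ m * v ^ n                      ≈⟨ *-identityˡ _ ⟨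
      1# * (u ^ m * v ^ n)               ≈⟨ *-congʳ (proj₂ (proj₂ inv)) ⟨
      (u * v) * (u ^ m * v ^ n)          ≈⟨ interchange u v _ _ ⟩
      u ^ ℕ.suc m * v ^ ℕ.suc n          ∎

    power-+ : ∀ r s → power u inv (r ℤ.+ s) ≈ power u inv r * power u inv s
    power-+ (+ m)    (+ n)    = ^-homo-* u m n
    power-+ (+ m)    -[1+ n ] = power-⊖ m (ℕ.suc n)
    power-+ -[1+ m ] (+ n)    = trans (power-⊖ n (ℕ.suc m)) (*-comm _ _)
    power-+ -[1+ m ] -[1+ n ] = begin
      v ^ (ℕ.suc (ℕ.suc (m ℕ.+ n)))  ≡⟨ ≡.cong (λ k → v ^ ℕ.suc k) (ℕ.+-suc m n) ⟨
      v ^ (ℕ.suc m ℕ.+ ℕ.suc n)      ≈⟨ ^-homo-* v (ℕ.suc m) (ℕ.suc n) ⟩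
      v ^ ℕ.suc m * v ^ ℕ.suc n      ∎

record CommutativeAlgebra {c ℓ} (K : CommutativeRing c ℓ) a ℓa : Set (c ⊔ ℓ ⊔ Level.suc (a ⊔ ℓa)) where
  infixr 7 _•_
  field
    commutativeRing : CommutativeRing a ℓa
  open CommutativeRing commutativeRing public
  field
    _•_          : CommutativeRing.Carrier K → Carrier → Carrier
    isLeftModule : IsLeftModule (CommutativeRing.ring K) _≈_ _+_ 0# -_ _•_
    •-*-assoc    : ∀ k x y → (k • x) * y ≈ k • (x * y)
  open IsLeftModule isLeftModule public using (*ₗ-cong; *ₗ-zeroʳ; *ₗ-distribˡ; *ₗ-distribʳ; *ₗ-assoc; *ₗ-identityˡ)

record RawGradedAlgebra {k} (K : Set k) a ℓ : Set (k ⊔ Level.suc (a ⊔ ℓ)) where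
  field
    rawRing : RawRing a ℓ
  open RawRing rawRing public
  field
    _•_         : K → Carrier → Carrier
    Homogeneous : ℤ → Pred Carrier ℓ

record IsGradedAlgebraIsomorphism
  {k a b ℓa ℓb} {K : Set k} (A : RawGradedAlgebra K a ℓa) (B : RawGradedAlgebra K b ℓb)
  (⟦_⟧ : RawGradedAlgebra.Carrier A → RawGradedAlgebra.Carrier B) : Set (k ⊔ a ⊔ b ⊔ ℓa ⊔ ℓb) where
  private
    module A = RawGradedAlgebra A
    module B = RawGradedAlgebra B
  field
    isRingIsomorphism : IsRingIsomorphism A.rawRing B.rawRing ⟦_⟧
    •-homo            : ∀ k x → ⟦ k A.• x ⟧ B.≈ k B.• ⟦ x ⟧
    homogeneous       : ∀ r x → A.Homogeneous r x ⇔ B.Homogeneous r ⟦ x ⟧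

-- A ℤ-indexed family of subspaces P r of a commutative K-algebra with
-- P r · P s ⊆ P (r + s) and 1 ∈ P 0.
record IsGradedFamily {c ℓ a ℓa p} {K : CommutativeRing c ℓ} (A : CommutativeAlgebra K a ℓa)
                      (P : ℤ → Pred (CommutativeAlgebra.Carrier A) p) : Set (c ⊔ a ⊔ ℓa ⊔ p) where
  open CommutativeAlgebra A
  field
    resp : ∀ {r} → P r Respects _≈_
    0∈   : ∀ {r} → P r 0#
    +∈   : ∀ {r x y} → P r x → P r y → P r (x + y)
    -∈   : ∀ {r x} → P r x → P r (- x)
    •∈   : ∀ {r} k {x} → P r x → P r (k • x)
    1∈   : P 0ℤ 1#
    *∈   : ∀ {r s x y} → P r x → P s y → P (r ℤ.+ s) (x * y)

module ZeroPart {c ℓ a ℓa p} {K : CommutativeRing c ℓ} (A : CommutativeAlgebra K a ℓa)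
                {P : ℤ → Pred (CommutativeAlgebra.Carrier A) p} (G : IsGradedFamily A P) where
  open CommutativeAlgebra A
  open IsGradedFamily G

  rawRing₀ : RawRing (a ⊔ p) ℓa
  rawRing₀ = record
    { Carrier = Σ Carrier (P 0ℤ)
    ; _≈_     = λ x y → proj₁ x ≈ proj₁ y
    ; _+_     = λ x y → proj₁ x + proj₁ y , +∈ (proj₂ x) (proj₂ y)
    ; _*_     = λ x y → proj₁ x * proj₁ y , *∈ (proj₂ x) (proj₂ y)
    ; -_      = λ x → - proj₁ x , -∈ (proj₂ x)
    ; 0#      = 0# , 0∈
    ; 1#      = 1# , 1∈
    }

  proj₁-isRingMonomorphism : IsRingMonomorphism rawRing₀ rawRing proj₁
  proj₁-isRingMonomorphism = record
    { isRingHomomorphism = record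
      { isSemiringHomomorphism = record
        { isNearSemiringHomomorphism = record
          { +-isMonoidHomomorphism = record
            { isMagmaHomomorphism = record
              { isRelHomomorphism = record { cong = id }
              ; homo = λ _ _ → refl
              }
            ; ε-homo = refl
            }
          ; *-homo = λ _ _ → refl
          }
        ; 1#-homo = refl
        }
      ; -‿homo = λ _ → refl
      }
    ; injective = id
    }

  zeroPart : CommutativeAlgebra K (a ⊔ p) ℓa
  zeroPart = record
    { commutativeRing = record
      { isCommutativeRing = RingMonomorphism.isCommutativeRing proj₁-isRingMonomorphism isCommutativeRing }
    ; _•_ = λ k x → k • proj₁ x , •∈ k (proj₂ x)
    ; isLeftModule = record
      { isLeftSemimodule = record
        { +ᴹ-isCommutativeMonoid =
            RingMonomorphism.+-isCommutativeMonoid proj₁-isRingMonomorphism +-isCommutativeMonoid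
        ; isPreleftSemimodule = record
          { *ₗ-cong      = *ₗ-cong
          ; *ₗ-zeroˡ     = λ x → IsLeftModule.*ₗ-zeroˡ isLeftModule (proj₁ x)
          ; *ₗ-distribʳ  = λ x → *ₗ-distribʳ (proj₁ x)
          ; *ₗ-identityˡ = λ x → *ₗ-identityˡ (proj₁ x)
          ; *ₗ-assoc     = λ j k x → *ₗ-assoc j k (proj₁ x)
          ; *ₗ-zeroʳ     = *ₗ-zeroʳ
          ; *ₗ-distribˡ  = λ k x y → *ₗ-distribˡ k (proj₁ x) (proj₁ y)
          }
        }
      ; -ᴹ‿cong    = -‿cong
      ; -ᴹ‿inverse = (λ x → -‿inverseˡ (proj₁ x)) , (λ x → -‿inverseʳ (proj₁ x))
      }
    ; •-*-assoc = λ k x y → •-*-assoc k (proj₁ x) (proj₁ y)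
    }

-- The external direct sum ⨁ᵣ P r: finitely supported families (f r)ᵣ with
-- f r ∈ P r, compared componentwise and multiplied by convolution.
module DirectSum {c ℓ a ℓa p} {K : CommutativeRing c ℓ} (A : CommutativeAlgebra K a ℓa)
                 {P : ℤ → Pred (CommutativeAlgebra.Carrier A) p} (G : IsGradedFamily A P) where
  open CommutativeAlgebra A
  open IsGradedFamily G
  open RingProperties ring using (-0#≈0#)

  record ⨁ : Set (a ⊔ ℓa ⊔ p) where
    field
      component : ℤ → Carrier
      member    : ∀ r → P r (component r)
      bound     : ℕ
      vanish    : ∀ r → bound ℕ.< ℤ.∣ r ∣ → component r ≈ 0#
  open ⨁ public

  -- window N h is the sum of h r over - N ≤ r ≤ N.
  window : ℕ → (ℤ → Carrier) → Carrier
  window zero    h = h 0ℤ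
  window (suc N) h = window N h + (h (+ ℕ.suc N) + h -[1+ N ])

  window-member : ∀ {t} N h → (∀ r → P t (h r)) → P t (window N h)
  window-member zero    h p = p _
  window-member (suc N) h p = +∈ (window-member N h p) (+∈ (p _) (p _))

  window-zero : ∀ N h → (∀ r → ℤ.∣ r ∣ ℕ.≤ N → h r ≈ 0#) → window N h ≈ 0#
  window-zero zero    h z = z 0ℤ z≤n
  window-zero (suc N) h z = trans
    (+-cong (window-zero N h (λ r r≤N → z r (ℕ.m≤n⇒m≤1+n r≤N)))
            (trans (+-cong (z _ ℕ.≤-refl) (z _ ℕ.≤-refl)) (+-identityˡ _)))
    (+-identityˡ _)

  convolution : ⨁ → ⨁ → ℤ → Carrier
  convolution f g t = window (bound f) (λ r → component f r * component g (t ℤ.- r))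

  private
    r+[t-r]≡t : ∀ r t → r ℤ.+ (t ℤ.- r) ≡ t
    r+[t-r]≡t r t = ≡.trans (ℤ.+-comm r (t ℤ.- r))
      (≡.trans (ℤ.+-assoc t (ℤ.- r) r)
      (≡.trans (≡.cong (ℤ._+_ t) (ℤ.+-inverseˡ r)) (ℤ.+-identityʳ t)))

    large : ∀ M N r t → M ℕ.+ N ℕ.< ℤ.∣ t ∣ → ℤ.∣ r ∣ ℕ.≤ M → N ℕ.< ℤ.∣ t ℤ.- r ∣
    large M N r t M+N<t r≤M = ℕ.+-cancelˡ-< M N _ (begin-strict
      M ℕ.+ N                        <⟨ M+N<t ⟩
      ℤ.∣ t ∣                        ≡⟨ ≡.cong ℤ.∣_∣ (r+[t-r]≡t r t) ⟨
      ℤ.∣ r ℤ.+ (t ℤ.- r) ∣          ≤⟨ ℤ.∣i+j∣≤∣i∣+∣j∣ r (t ℤ.- r) ⟩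
      ℤ.∣ r ∣ ℕ.+ ℤ.∣ t ℤ.- r ∣      ≤⟨ ℕ.+-monoˡ-≤ _ r≤M ⟩
      M ℕ.+ ℤ.∣ t ℤ.- r ∣            ∎)
      where open ℕ.≤-Reasoning

  _≋_ : Rel ⨁ ℓa
  f ≋ g = ∀ r → component f r ≈ component g r

  single : ∀ r (x : Carrier) → P r x → ⨁
  single r x x∈ = record
    { component = at
    ; member    = at-member
    ; bound     = ℤ.∣ r ∣
    ; vanish    = at-vanish
    }
    where
    at : ℤ → Carrier
    at s with s ℤ.≟ r
    ... | yes _ = x
    ... | no  _ = 0#
    at-member : ∀ s → P s (at s)
    at-member s with s ℤ.≟ r
    ... | yes ≡.refl = x∈
    ... | no  _      = 0∈
    at-vanish : ∀ s → ℤ.∣ r ∣ ℕ.< ℤ.∣ s ∣ → at s ≈ 0#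
    at-vanish s r<s with s ℤ.≟ r
    ... | yes ≡.refl = contradiction r<s (ℕ.<-irrefl ≡.refl)
    ... | no  _      = refl

  _⊕_ : ⨁ → ⨁ → ⨁
  f ⊕ g = record
    { component = λ r → component f r + component g r
    ; member    = λ r → +∈ (member f r) (member g r)
    ; bound     = bound f ℕ.+ bound g
    ; vanish    = λ r b<r → trans
        (+-cong (vanish f r (ℕ.≤-<-trans (ℕ.m≤m+n _ _) b<r))
                (vanish g r (ℕ.≤-<-trans (ℕ.m≤n+m _ _) b<r)))
        (+-identityˡ _)
    }

  _⊗_ : ⨁ → ⨁ → ⨁
  f ⊗ g = record
    { component = convolution f g
    ; member    = λ t → window-member (bound f) _ λ r →
        ≡.subst (λ s → P s (component f r * component g (t ℤ.- r))) (r+[t-r]≡t r t)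
          (*∈ (member f r) (member g (t ℤ.- r)))
    ; bound     = bound f ℕ.+ bound g
    ; vanish    = λ t b<t → window-zero (bound f) _ λ r r≤b →
        trans (*-congˡ (vanish g (t ℤ.- r) (large (bound f) (bound g) r t b<t r≤b))) (zeroʳ _)
    }

  ⊖_ : ⨁ → ⨁
  ⊖ f = record
    { component = λ r → - component f r
    ; member    = λ r → -∈ (member f r)
    ; bound     = bound f
    ; vanish    = λ r b<r → trans (-‿cong (vanish f r b<r)) -0#≈0#
    }

  scale : CommutativeRing.Carrier K → ⨁ → ⨁
  scale k f = record
    { component = λ r → k • component f r
    ; member    = λ r → •∈ k (member f r)
    ; bound     = bound f
    ; vanish    = λ r b<r → trans (*ₗ-cong (CommutativeRing.refl K) (vanish f r b<r)) (*ₗ-zeroʳ k)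
    }

  -- The r-th summand is given degree deg r.
  gradedAlgebra : (deg : ℤ → ℤ) → RawGradedAlgebra (CommutativeRing.Carrier K) (a ⊔ ℓa ⊔ p) ℓa
  gradedAlgebra deg = record
    { rawRing = record
      { Carrier = ⨁
      ; _≈_     = _≋_
      ; _+_     = _⊕_
      ; _*_     = _⊗_
      ; -_      = ⊖_
      ; 0#      = single 0ℤ 0# 0∈
      ; 1#      = single 0ℤ 1# 1∈
      }
    ; _•_         = scale
    ; Homogeneous = λ d f → ∀ r → deg r ≢ d → component f r ≈ 0#
    }

-- S[T, T⁻¹]: finitely supported families of coefficients in S, the j-th one
-- being the coefficient of T ^ j.
module LaurentPolynomials {c ℓ a ℓa} {K : CommutativeRing c ℓ} (S : CommutativeAlgebra K a ℓa) where
  open CommutativeAlgebra S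

  allCoefficients : IsGradedFamily S (λ _ _ → ⊤ {a})
  allCoefficients = _

  open DirectSum S allCoefficients using (⨁; single; gradedAlgebra)

  laurentAlgebra : (degT : ℤ) → RawGradedAlgebra (CommutativeRing.Carrier K) (a ⊔ ℓa) ℓa
  laurentAlgebra degT = gradedAlgebra (λ j → degT ℤ.* j)

  monomial : Carrier → ℤ → ⨁
  monomial ρ j = single j ρ tt

module PowerSeries {c ℓ} (K : CommutativeRing c ℓ) where
  open CommutativeRing K
  open SemiringSum semiring
    using (sum; sum-cong-≋; sum-replicate-zero; ∑-distrib-+; ∑-comm; *-distribˡ-sum)
  open CommutativeSemigroupProperties +-commutativeSemigroup using ()
    renaming (x∙yz≈y∙xz to x+[y+z]≈y+[x+z])
  open CommutativeSemigroupProperties *-commutativeSemigroup using (x∙yz≈y∙xz)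
  open SetoidReasoning setoid

  Series : Set c
  Series = ℕ → Carrier

  infix 4 _≐_
  _≐_ : Rel Series ℓ
  φ ≐ ψ = ∀ n → φ n ≈ ψ n

  infixl 7 _⊛_
  _⊛_ : Series → Series → Series
  (φ ⊛ ψ) n = sum {ℕ.suc n} (λ k → φ (toℕ k) * ψ (n ∸ toℕ k))

  constant : Carrier → Series
  constant k zero    = k
  constant k (suc _) = 0#

  X : Series
  X 1 = 1#
  X _ = 0#

  infixl 6 _+̇_
  _+̇_ : Series → Series → Series
  (φ +̇ ψ) n = φ n + ψ n

  infixr 7 _•̇_
  _•̇_ : Carrier → Series → Series
  (k •̇ φ) n = k * φ n

  tail : Series → Series
  tail φ n = φ (ℕ.suc n)

  sum-zero : ∀ {n} (f : Fin n → Carrier) → (∀ k → f k ≈ 0#) → sum f ≈ 0#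
  sum-zero {n} f z = trans (sum-cong-≋ z) (sum-replicate-zero n)

  ⊛-cong≤ : ∀ {φ φ′ ψ ψ′} n → (∀ m → m ℕ.≤ n → φ m ≈ φ′ m) → (∀ m → m ℕ.≤ n → ψ m ≈ ψ′ m) →
            (φ ⊛ ψ) n ≈ (φ′ ⊛ ψ′) n
  ⊛-cong≤ n p q = sum-cong-≋ {ℕ.suc n} λ k → *-cong (p (toℕ k) (Fin.toℕ≤pred[n] k)) (q (n ∸ toℕ k) (ℕ.m∸n≤m n (toℕ k)))

  ⊛-cong : ∀ {φ φ′ ψ ψ′} → φ ≐ φ′ → ψ ≐ ψ′ → φ ⊛ ψ ≐ φ′ ⊛ ψ′
  ⊛-cong p q n = ⊛-cong≤ n (λ m _ → p m) (λ m _ → q m)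

  ⊛-distribʳ : ∀ χ φ ψ → (φ +̇ ψ) ⊛ χ ≐ φ ⊛ χ +̇ ψ ⊛ χ
  ⊛-distribʳ χ φ ψ n = trans (sum-cong-≋ {ℕ.suc n} λ k → distribʳ (χ (n ∸ toℕ k)) (φ (toℕ k)) (ψ (toℕ k)))
    (∑-distrib-+ {ℕ.suc n} (λ k → φ (toℕ k) * χ (n ∸ toℕ k)) (λ k → ψ (toℕ k) * χ (n ∸ toℕ k)))

  •-⊛-assoc : ∀ k φ ψ → (k •̇ φ) ⊛ ψ ≐ k •̇ (φ ⊛ ψ)
  •-⊛-assoc k φ ψ n = trans (sum-cong-≋ {ℕ.suc n} λ i → *-assoc k (φ (toℕ i)) (ψ (n ∸ toℕ i)))
    (sym (*-distribˡ-sum {ℕ.suc n} k (λ i → φ (toℕ i) * ψ (n ∸ toℕ i))))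

  ⊛-zeroˡ : ∀ φ → (λ _ → 0#) ⊛ φ ≐ (λ _ → 0#)
  ⊛-zeroˡ φ n = sum-zero {ℕ.suc n} _ λ k → zeroˡ (φ (n ∸ toℕ k))

  constant-⊛ : ∀ k φ → constant k ⊛ φ ≐ k •̇ φ
  constant-⊛ k φ zero    = +-identityʳ _
  constant-⊛ k φ (suc n) = trans (+-congˡ (⊛-zeroˡ φ n)) (+-identityʳ _)

  ⊛-assoc : ∀ φ ψ χ → (φ ⊛ ψ) ⊛ χ ≐ φ ⊛ (ψ ⊛ χ)
  ⊛-assoc φ ψ χ zero = +-congʳ (begin
    (φ 0 * ψ 0 + 0#) * χ 0   ≈⟨ *-congʳ (+-identityʳ _) ⟩
    φ 0 * ψ 0 * χ 0          ≈⟨ *-assoc _ _ _ ⟩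
    φ 0 * (ψ 0 * χ 0)        ≈⟨ *-congˡ (+-identityʳ _) ⟨
    φ 0 * (ψ 0 * χ 0 + 0#)   ∎)
  ⊛-assoc φ ψ χ (suc n) = begin
    (φ 0 * ψ 0 + 0#) * χ (ℕ.suc n) + ((φ 0 •̇ tail ψ +̇ tail φ ⊛ ψ) ⊛ χ) n
      ≈⟨ +-cong (trans (*-congʳ (+-identityʳ _)) (*-assoc _ _ _))
                (⊛-distribʳ χ (φ 0 •̇ tail ψ) (tail φ ⊛ ψ) n) ⟩
    φ 0 * (ψ 0 * χ (ℕ.suc n)) + (((φ 0 •̇ tail ψ) ⊛ χ) n + ((tail φ ⊛ ψ) ⊛ χ) n)
      ≈⟨ +-congˡ (+-cong (•-⊛-assoc (φ 0) (tail ψ) χ n) (⊛-assoc (tail φ) ψ χ n)) ⟩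
    φ 0 * (ψ 0 * χ (ℕ.suc n)) + (φ 0 * (tail ψ ⊛ χ) n + (tail φ ⊛ (ψ ⊛ χ)) n)
      ≈⟨ +-assoc _ _ _ ⟨
    φ 0 * (ψ 0 * χ (ℕ.suc n)) + φ 0 * (tail ψ ⊛ χ) n + (tail φ ⊛ (ψ ⊛ χ)) n
      ≈⟨ +-congʳ (distribˡ _ _ _) ⟨
    φ 0 * (ψ ⊛ χ) (ℕ.suc n) + (tail φ ⊛ (ψ ⊛ χ)) n ∎

  ⊛-sucʳ : ∀ φ ψ n → (φ ⊛ ψ) (ℕ.suc n) ≈ ψ 0 * φ (ℕ.suc n) + (φ ⊛ tail ψ) n
  ⊛-sucʳ φ ψ zero = begin
    φ 0 * ψ 1 + (φ 1 * ψ 0 + 0#)  ≈⟨ x+[y+z]≈y+[x+z] _ _ _ ⟩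
    φ 1 * ψ 0 + (φ 0 * ψ 1 + 0#)  ≈⟨ +-congʳ (*-comm _ _) ⟩
    ψ 0 * φ 1 + (φ 0 * ψ 1 + 0#)  ∎
  ⊛-sucʳ φ ψ (suc n) = trans (+-congˡ (⊛-sucʳ (tail φ) ψ n)) (x+[y+z]≈y+[x+z] _ _ _)

  ⊛-comm : ∀ φ ψ → φ ⊛ ψ ≐ ψ ⊛ φ
  ⊛-comm φ ψ zero    = +-congʳ (*-comm _ _)
  ⊛-comm φ ψ (suc n) = trans (⊛-sucʳ φ ψ n) (+-congˡ (⊛-comm φ (tail ψ) n))

  K[[x]] : CommutativeRing c ℓ
  K[[x]] = record
    { Carrier = Series
    ; _≈_     = _≐_
    ; _+_     = _+̇_
    ; _*_     = _⊛_
    ; -_      = λ φ n → - φ n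
    ; 0#      = λ _ → 0#
    ; 1#      = constant 1#
    ; isCommutativeRing = record
      { isRing = record
        { +-isAbelianGroup = Pointwise.isAbelianGroup ℕ +-isAbelianGroup
        ; *-cong           = ⊛-cong
        ; *-assoc          = ⊛-assoc
        ; *-identity       = identityˡ , λ φ n → trans (⊛-comm φ (constant 1#) n) (identityˡ φ n)
        ; distrib          = (λ χ φ ψ n → trans (⊛-comm χ (φ +̇ ψ) n)
                                (trans (⊛-distribʳ χ φ ψ n) (+-cong (⊛-comm φ χ n) (⊛-comm ψ χ n))))
                           , ⊛-distribʳ
        }
      ; *-comm = ⊛-comm
      }
    }
    where
    identityˡ : ∀ φ → constant 1# ⊛ φ ≐ φ
    identityˡ φ n = trans (constant-⊛ 1# φ n) (*-identityˡ _)

  seriesAlgebra : CommutativeAlgebra K c ℓ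
  seriesAlgebra = record
    { commutativeRing = K[[x]]
    ; _•_ = _•̇_
    ; isLeftModule = record
      { isLeftSemimodule = record
        { +ᴹ-isCommutativeMonoid = CommutativeRing.+-isCommutativeMonoid K[[x]]
        ; isPreleftSemimodule = record
          { *ₗ-cong      = λ k≈ φ≐ n → *-cong k≈ (φ≐ n)
          ; *ₗ-zeroˡ     = λ φ n → zeroˡ (φ n)
          ; *ₗ-distribʳ  = λ φ j k n → distribʳ (φ n) j k
          ; *ₗ-identityˡ = λ φ n → *-identityˡ (φ n)
          ; *ₗ-assoc     = λ j k φ n → *-assoc j k (φ n)
          ; *ₗ-zeroʳ     = λ k n → zeroʳ k
          ; *ₗ-distribˡ  = λ k φ ψ n → distribˡ k (φ n) (ψ n)
          }
        }
      ; -ᴹ‿cong    = CommutativeRing.-‿cong K[[x]]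
      ; -ᴹ‿inverse = CommutativeRing.-‿inverse K[[x]]
      }
    ; •-*-assoc = •-⊛-assoc
    }

  open SemiringExp (CommutativeRing.semiring K[[x]]) public using (_^_)

  -- φ(ψ(x)).  This is the substitution of ψ into φ only when ψ has zero constant
  -- term: then ψ ^ k has no term of degree n < k, so Σₖ φₖ ψ ^ k may be
  -- truncated at k = n in degree n.
  _⟨_⟩ : Series → Series → Series
  (φ ⟨ ψ ⟩) n = sum {ℕ.suc n} (λ k → φ (toℕ k) * (ψ ^ toℕ k) n)

  -- sum-truncate and linear-⊛ allow the truncated sums to be manipulated as
  -- if they were Σₖ φₖ ψ ^ k.
  sum-truncate : ∀ m n (h : ℕ → Carrier) → m ℕ.≤ n → (∀ k → m ℕ.< k → h k ≈ 0#) →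
                 sum {ℕ.suc n} (λ k → h (toℕ k)) ≈ sum {ℕ.suc m} (λ k → h (toℕ k))
  sum-truncate zero    n       h _         z = +-congˡ (sum-zero {n} _ λ k → z _ (s≤s z≤n))
  sum-truncate (suc m) (suc n) h (s≤s m≤n) z =
    +-congˡ (sum-truncate m n (λ k → h (ℕ.suc k)) m≤n (λ k m<k → z _ (s≤s m<k)))

  linear-⊛ : ∀ {N} τ (b : Fin N → Carrier) (B : Fin N → Series) n →
             (τ ⊛ (λ m → sum (λ k → b k * B k m))) n ≈ sum (λ k → b k * (τ ⊛ B k) n)
  linear-⊛ {N} τ b B n = begin
    sum {ℕ.suc n} (λ i → τ (toℕ i) * sum (λ k → b k * B k (n ∸ toℕ i)))
      ≈⟨ sum-cong-≋ {ℕ.suc n} (λ i → *-distribˡ-sum (τ (toℕ i)) (λ k → b k * B k (n ∸ toℕ i))) ⟩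
    sum {ℕ.suc n} (λ i → sum (λ k → τ (toℕ i) * (b k * B k (n ∸ toℕ i))))
      ≈⟨ ∑-comm {ℕ.suc n} {N} (λ i k → τ (toℕ i) * (b k * B k (n ∸ toℕ i))) ⟩
    sum (λ k → sum {ℕ.suc n} (λ i → τ (toℕ i) * (b k * B k (n ∸ toℕ i))))
      ≈⟨ sum-cong-≋ (λ k → trans
           (sum-cong-≋ {ℕ.suc n} (λ i → x∙yz≈y∙xz (τ (toℕ i)) (b k) (B k (n ∸ toℕ i))))
           (sym (*-distribˡ-sum {ℕ.suc n} (b k) (λ i → τ (toℕ i) * B k (n ∸ toℕ i))))) ⟩
    sum (λ k → b k * (τ ⊛ B k) n) ∎

  module Substitution (σ : Series) (σ₀≈0 : σ 0 ≈ 0#) where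

    σ⊛-zero : ∀ φ → (σ ⊛ φ) 0 ≈ 0#
    σ⊛-zero φ = trans (+-identityʳ _) (trans (*-congʳ σ₀≈0) (zeroˡ _))

    σ⊛-suc : ∀ φ n → (σ ⊛ φ) (ℕ.suc n) ≈ (tail σ ⊛ φ) n
    σ⊛-suc φ n = trans (+-congʳ (trans (*-congʳ σ₀≈0) (zeroˡ _))) (+-identityˡ _)

    σ^-vanish : ∀ k m → m ℕ.< k → (σ ^ k) m ≈ 0#
    σ^-vanish (suc k) zero    _         = σ⊛-zero (σ ^ k)
    σ^-vanish (suc k) (suc m) (s≤s m<k) = trans (σ⊛-suc (σ ^ k) m)
      (sum-zero {ℕ.suc m} _ λ i → trans
        (*-congˡ (σ^-vanish k _ (ℕ.≤-<-trans (ℕ.m∸n≤m m (toℕ i)) m<k))) (zeroʳ (σ (ℕ.suc (toℕ i)))))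

    ⟨σ⟩-unfold : ∀ φ → φ ⟨ σ ⟩ ≐ constant (φ 0) +̇ σ ⊛ (tail φ ⟨ σ ⟩)
    ⟨σ⟩-unfold φ zero    = trans (+-identityʳ _) (trans (*-identityʳ _)
      (sym (trans (+-congˡ (σ⊛-zero (tail φ ⟨ σ ⟩))) (+-identityʳ _))))
    ⟨σ⟩-unfold φ (suc n) = begin
      φ 0 * 0# + sum {ℕ.suc n} (λ k → φ (ℕ.suc (toℕ k)) * (σ ⊛ σ ^ toℕ k) (ℕ.suc n))
        ≈⟨ +-cong (zeroʳ _) (sum-cong-≋ {ℕ.suc n} (λ k → *-congˡ {φ (ℕ.suc (toℕ k))} (σ⊛-suc (σ ^ toℕ k) n))) ⟩
      0# + sum {ℕ.suc n} (λ k → φ (ℕ.suc (toℕ k)) * (tail σ ⊛ σ ^ toℕ k) n)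
        ≈⟨ +-congˡ (linear-⊛ {ℕ.suc n} (tail σ) (λ k → φ (ℕ.suc (toℕ k))) (λ k → σ ^ toℕ k) n) ⟨
      0# + (tail σ ⊛ (λ m → sum {ℕ.suc n} (λ k → φ (ℕ.suc (toℕ k)) * (σ ^ toℕ k) m))) n
        ≈⟨ +-congˡ (⊛-cong≤ {tail σ} n (λ _ _ → refl) (λ m m≤n →
             sum-truncate m n (λ k → φ (ℕ.suc k) * (σ ^ k) m) m≤n
               (λ k m<k → trans (*-congˡ (σ^-vanish k m m<k)) (zeroʳ _)))) ⟩
      0# + (tail σ ⊛ (tail φ ⟨ σ ⟩)) n
        ≈⟨ +-congˡ (σ⊛-suc (tail φ ⟨ σ ⟩) n) ⟨
      0# + (σ ⊛ (tail φ ⟨ σ ⟩)) (ℕ.suc n) ∎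

    ⟨σ⟩-cong : ∀ {φ ψ} → φ ≐ ψ → φ ⟨ σ ⟩ ≐ ψ ⟨ σ ⟩
    ⟨σ⟩-cong φ≐ψ n = sum-cong-≋ {ℕ.suc n} λ k → *-congʳ {(σ ^ toℕ k) n} (φ≐ψ (toℕ k))

    ⟨σ⟩-+ : ∀ φ ψ → (φ +̇ ψ) ⟨ σ ⟩ ≐ φ ⟨ σ ⟩ +̇ ψ ⟨ σ ⟩
    ⟨σ⟩-+ φ ψ n = trans (sum-cong-≋ {ℕ.suc n} λ k → distribʳ ((σ ^ toℕ k) n) (φ (toℕ k)) (ψ (toℕ k)))
      (∑-distrib-+ {ℕ.suc n} (λ k → φ (toℕ k) * (σ ^ toℕ k) n) (λ k → ψ (toℕ k) * (σ ^ toℕ k) n))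

    ⟨σ⟩-• : ∀ k φ → (k •̇ φ) ⟨ σ ⟩ ≐ k •̇ (φ ⟨ σ ⟩)
    ⟨σ⟩-• k φ n = trans (sum-cong-≋ {ℕ.suc n} λ i → *-assoc k (φ (toℕ i)) ((σ ^ toℕ i) n))
      (sym (*-distribˡ-sum {ℕ.suc n} k (λ i → φ (toℕ i) * (σ ^ toℕ i) n)))

    ⟨σ⟩-0 : (λ _ → 0#) ⟨ σ ⟩ ≐ (λ _ → 0#)
    ⟨σ⟩-0 n = sum-zero {ℕ.suc n} _ λ k → zeroˡ ((σ ^ toℕ k) n)

    ⟨σ⟩-1 : constant 1# ⟨ σ ⟩ ≐ constant 1#
    ⟨σ⟩-1 n = trans (⟨σ⟩-unfold (constant 1#) n) (trans (+-congˡ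
      (sum-zero {ℕ.suc n} _ λ k → trans (*-congˡ {σ (toℕ k)} (⟨σ⟩-0 (n ∸ toℕ k))) (zeroʳ (σ (toℕ k))))) (+-identityʳ _))

    ⟨σ⟩-⊛≤ : ∀ N φ ψ n → n ℕ.≤ N → ((φ ⊛ ψ) ⟨ σ ⟩) n ≈ ((φ ⟨ σ ⟩) ⊛ (ψ ⟨ σ ⟩)) n
    ⟨σ⟩-⊛≤ N φ ψ n n≤N = begin
      ((φ ⊛ ψ) ⟨ σ ⟩) n
        ≈⟨ ⟨σ⟩-unfold (φ ⊛ ψ) n ⟩
      constant (φ 0 * ψ 0 + 0#) n + (σ ⊛ ((φ 0 •̇ tail ψ +̇ tail φ ⊛ ψ) ⟨ σ ⟩)) n
        ≈⟨ +-cong (constant-head n) (R.*-congˡ {σ} (λ m → trans (⟨σ⟩-+ (φ 0 •̇ tail ψ) (tail φ ⊛ ψ) m)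
             (+-congʳ (⟨σ⟩-• (φ 0) (tail ψ) m))) n) ⟩
      φ 0 * constant (ψ 0) n + (σ ⊛ (φ 0 •̇ (tail ψ ⟨ σ ⟩) +̇ (tail φ ⊛ ψ) ⟨ σ ⟩)) n
        ≈⟨ +-congˡ (R.distribˡ σ (φ 0 •̇ (tail ψ ⟨ σ ⟩)) ((tail φ ⊛ ψ) ⟨ σ ⟩) n) ⟩
      φ 0 * constant (ψ 0) n + ((σ ⊛ (φ 0 •̇ (tail ψ ⟨ σ ⟩))) n + (σ ⊛ ((tail φ ⊛ ψ) ⟨ σ ⟩)) n)
        ≈⟨ +-congˡ (+-cong pull (step N n n≤N)) ⟩
      φ 0 * constant (ψ 0) n + (φ 0 * (σ ⊛ (tail ψ ⟨ σ ⟩)) n + (σ ⊛ ((tail φ ⟨ σ ⟩) ⊛ (ψ ⟨ σ ⟩))) n)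
        ≈⟨ +-assoc _ _ _ ⟨
      φ 0 * constant (ψ 0) n + φ 0 * (σ ⊛ (tail ψ ⟨ σ ⟩)) n + (σ ⊛ ((tail φ ⟨ σ ⟩) ⊛ (ψ ⟨ σ ⟩))) n
        ≈⟨ +-congʳ (trans (*-congˡ (⟨σ⟩-unfold ψ n)) (distribˡ _ _ _)) ⟨
      φ 0 * (ψ ⟨ σ ⟩) n + (σ ⊛ ((tail φ ⟨ σ ⟩) ⊛ (ψ ⟨ σ ⟩))) n
        ≈⟨ +-cong (constant-⊛ (φ 0) (ψ ⟨ σ ⟩) n) (⊛-assoc σ (tail φ ⟨ σ ⟩) (ψ ⟨ σ ⟩) n) ⟨
      (constant (φ 0) ⊛ (ψ ⟨ σ ⟩)) n + ((σ ⊛ (tail φ ⟨ σ ⟩)) ⊛ (ψ ⟨ σ ⟩)) n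
        ≈⟨ ⊛-distribʳ (ψ ⟨ σ ⟩) (constant (φ 0)) (σ ⊛ (tail φ ⟨ σ ⟩)) n ⟨
      ((constant (φ 0) +̇ σ ⊛ (tail φ ⟨ σ ⟩)) ⊛ (ψ ⟨ σ ⟩)) n
        ≈⟨ R.*-congʳ {ψ ⟨ σ ⟩} (⟨σ⟩-unfold φ) n ⟨
      ((φ ⟨ σ ⟩) ⊛ (ψ ⟨ σ ⟩)) n ∎
      where
      module R = CommutativeRing K[[x]]

      constant-head : ∀ n → constant (φ 0 * ψ 0 + 0#) n ≈ φ 0 * constant (ψ 0) n
      constant-head zero    = +-identityʳ _
      constant-head (suc _) = sym (zeroʳ _)

      pull : (σ ⊛ (φ 0 •̇ (tail ψ ⟨ σ ⟩))) n ≈ φ 0 * (σ ⊛ (tail ψ ⟨ σ ⟩)) n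
      pull = trans (⊛-comm σ (φ 0 •̇ (tail ψ ⟨ σ ⟩)) n)
        (trans (•-⊛-assoc (φ 0) (tail ψ ⟨ σ ⟩) σ n) (*-congˡ (⊛-comm (tail ψ ⟨ σ ⟩) σ n)))

      step : ∀ N n → n ℕ.≤ N →
             (σ ⊛ ((tail φ ⊛ ψ) ⟨ σ ⟩)) n ≈ (σ ⊛ ((tail φ ⟨ σ ⟩) ⊛ (ψ ⟨ σ ⟩))) n
      step N       zero    _         =
        trans (σ⊛-zero ((tail φ ⊛ ψ) ⟨ σ ⟩)) (sym (σ⊛-zero ((tail φ ⟨ σ ⟩) ⊛ (ψ ⟨ σ ⟩))))
      step (suc N) (suc n) (s≤s n≤N) = trans (σ⊛-suc ((tail φ ⊛ ψ) ⟨ σ ⟩) n) (trans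
        (⊛-cong≤ {tail σ} n (λ _ _ → refl) (λ m m≤n → ⟨σ⟩-⊛≤ N (tail φ) ψ m (ℕ.≤-trans m≤n n≤N)))
        (sym (σ⊛-suc ((tail φ ⟨ σ ⟩) ⊛ (ψ ⟨ σ ⟩)) n)))

    ⟨σ⟩-⊛ : ∀ φ ψ → (φ ⊛ ψ) ⟨ σ ⟩ ≐ (φ ⟨ σ ⟩) ⊛ (ψ ⟨ σ ⟩)
    ⟨σ⟩-⊛ φ ψ n = ⟨σ⟩-⊛≤ n φ ψ n ℕ.≤-refl

module GradedSeries {c ℓ} (K : CommutativeRing c ℓ) where
  private
    module K = CommutativeRing K
  open PowerSeries K
  open CommutativeRing K[[x]]
  open Definitions _≈_ using (Invertible)
  open IntegerPower K[[x]]
  open RingProperties ring using (-‿distribˡ-*; -‿distribʳ-*; -‿involutive; -‿+-comm)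
  open CommutativeSemigroupProperties *-commutativeSemigroup using (interchange)
  open SetoidReasoning setoid

  geometric : Series
  geometric _ = K.1#

  [1-x]*geometric : (1# - X) * geometric ≈ 1#
  [1-x]*geometric = begin
    (1# - X) * geometric                   ≈⟨ distribʳ geometric 1# (- X) ⟩
    1# * geometric + - X * geometric       ≈⟨ +-cong (*-identityˡ geometric) (sym (-‿distribˡ-* X geometric)) ⟩
    geometric - X * geometric              ≈⟨ telescope ⟩
    1#                                     ∎
    where
    telescope : geometric - X * geometric ≈ 1#
    telescope zero = K.trans
      (K.+-congˡ (K.trans (K.-‿cong (Substitution.σ⊛-zero X K.refl geometric)) (RingProperties.-0#≈0# K.ring)))
      (K.+-identityʳ _)
    telescope (suc n) = K.trans
      (K.+-congˡ (K.-‿cong (K.trans (Substitution.σ⊛-suc X K.refl geometric n)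
        (K.trans (⊛-cong {tail X} {1#} {geometric} tailX (λ _ → K.refl) n) (*-identityˡ geometric n)))))
      (K.-‿inverseʳ _)
      where
      tailX : tail X ≈ 1#
      tailX zero    = K.refl
      tailX (suc _) = K.refl

  1-x-invertible : Invertible 1# _*_ (1# - X)
  1-x-invertible = geometric , trans (*-comm geometric (1# - X)) [1-x]*geometric , [1-x]*geometric

  x-1-invertible : Invertible 1# _*_ (X - 1#)
  x-1-invertible = - geometric , trans (*-comm (- geometric) (X - 1#)) inverse , inverse
    where
    inverse : (X - 1#) * - geometric ≈ 1#
    inverse = begin
      (X - 1#) * - geometric      ≈⟨ -‿distribʳ-* (X - 1#) geometric ⟨
      - ((X - 1#) * geometric)    ≈⟨ -‿distribˡ-* (X - 1#) geometric ⟩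
      - (X - 1#) * geometric      ≈⟨ *-congʳ {geometric} (begin
        - (X - 1#)       ≈⟨ -‿+-comm X (- 1#) ⟨
        - X - - 1#       ≈⟨ +-congˡ { - X} (-‿involutive 1#) ⟩
        - X + 1#         ≈⟨ +-comm (- X) 1# ⟩
        1# - X           ∎) ⟩
      (1# - X) * geometric        ≈⟨ [1-x]*geometric ⟩
      1#                          ∎

  x/[x-1] : Series
  x/[x-1] = X * proj₁ x-1-invertible

  x/[x-1]-constantTerm : x/[x-1] 0 K.≈ K.0#
  x/[x-1]-constantTerm = Substitution.σ⊛-zero X K.refl (proj₁ x-1-invertible)

  𝓕⟨_⟩ : ℤ → Pred Series ℓ
  𝓕⟨ r ⟩ φ = φ ⟨ x/[x-1] ⟩ ≈ power (1# - X) 1-x-invertible r * φ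

  𝓕-isGradedFamily : IsGradedFamily seriesAlgebra 𝓕⟨_⟩
  𝓕-isGradedFamily = record
    { resp = λ {r} {φ} {ψ} φ≈ψ φ∈ → begin
        ψ ⟨ x/[x-1] ⟩  ≈⟨ ⟨σ⟩-cong φ≈ψ ⟨
        φ ⟨ x/[x-1] ⟩  ≈⟨ φ∈ ⟩
        u r * φ        ≈⟨ *-congˡ {u r} φ≈ψ ⟩
        u r * ψ        ∎
    ; 0∈ = λ {r} → trans ⟨σ⟩-0 (sym (zeroʳ (u r)))
    ; +∈ = λ {r} {φ} {ψ} φ∈ ψ∈ → begin
        (φ + ψ) ⟨ x/[x-1] ⟩              ≈⟨ ⟨σ⟩-+ φ ψ ⟩
        φ ⟨ x/[x-1] ⟩ + ψ ⟨ x/[x-1] ⟩    ≈⟨ +-cong φ∈ ψ∈ ⟩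
        u r * φ + u r * ψ                ≈⟨ distribˡ (u r) φ ψ ⟨
        u r * (φ + ψ)                    ∎
    ; -∈ = λ {r} {φ} φ∈ → begin
        (- φ) ⟨ x/[x-1] ⟩             ≈⟨ ⟨σ⟩-cong (λ n → RingProperties.-1*x≈-x K.ring (φ n)) ⟨
        ((K.- K.1#) •̇ φ) ⟨ x/[x-1] ⟩  ≈⟨ •-member r (K.- K.1#) φ φ∈ ⟩
        u r * ((K.- K.1#) •̇ φ)        ≈⟨ *-congˡ {u r} (λ n → RingProperties.-1*x≈-x K.ring (φ n)) ⟩
        u r * - φ                     ∎
    ; •∈ = λ {r} k {φ} → •-member r k φ
    ; 1∈ = trans ⟨σ⟩-1 (sym (*-identityˡ 1#))
    ; *∈ = λ {r} {s} {φ} {ψ} φ∈ ψ∈ → begin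
        (φ * ψ) ⟨ x/[x-1] ⟩              ≈⟨ ⟨σ⟩-⊛ φ ψ ⟩
        φ ⟨ x/[x-1] ⟩ * ψ ⟨ x/[x-1] ⟩    ≈⟨ *-cong φ∈ ψ∈ ⟩
        (u r * φ) * (u s * ψ)            ≈⟨ interchange (u r) φ (u s) ψ ⟩
        (u r * u s) * (φ * ψ)            ≈⟨ *-congʳ {φ * ψ} (power-+ (1# - X) 1-x-invertible r s) ⟨
        u (r ℤ.+ s) * (φ * ψ)            ∎
    }
    where
    open Substitution x/[x-1] x/[x-1]-constantTerm

    u : ℤ → Series
    u = power (1# - X) 1-x-invertible

    •-member : ∀ r k φ → 𝓕⟨ r ⟩ φ → 𝓕⟨ r ⟩ (k •̇ φ)
    •-member r k φ φ∈ = begin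
      (k •̇ φ) ⟨ x/[x-1] ⟩    ≈⟨ ⟨σ⟩-• k φ ⟩
      k •̇ (φ ⟨ x/[x-1] ⟩)    ≈⟨ (λ n → K.*-congˡ (φ∈ n)) ⟩
      k •̇ (u r * φ)          ≈⟨ (λ n → K.*-congˡ (*-comm (u r) φ n)) ⟩
      k •̇ (φ * u r)          ≈⟨ •-⊛-assoc k φ (u r) ⟨
      (k •̇ φ) * u r          ≈⟨ *-comm (k •̇ φ) (u r) ⟩
      u r * (k •̇ φ)          ∎

  𝓕₀ : CommutativeAlgebra K (c ⊔ ℓ) ℓ
  𝓕₀ = ZeroPart.zeroPart seriesAlgebra 𝓕-isGradedFamily

  𝓕 : RawGradedAlgebra K.Carrier (c ⊔ ℓ) ℓ
  𝓕 = DirectSum.gradedAlgebra seriesAlgebra 𝓕-isGradedFamily id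

  inDegree : ∀ r φ → 𝓕⟨ r ⟩ φ → RawGradedAlgebra.Carrier 𝓕
  inDegree = DirectSum.single seriesAlgebra 𝓕-isGradedFamily

  𝓕₀[T,T⁻¹] : RawGradedAlgebra K.Carrier (c ⊔ ℓ) ℓ
  𝓕₀[T,T⁻¹] = LaurentPolynomials.laurentAlgebra 𝓕₀ -1ℤ

  infix 8 _T^_
  _T^_ : CommutativeAlgebra.Carrier 𝓕₀ → ℤ → RawGradedAlgebra.Carrier 𝓕₀[T,T⁻¹]
  _T^_ = LaurentPolynomials.monomial 𝓕₀

  g₋₁ : Series
  g₋₁ = X - constant (K.1# K.+ K.1#)

{-# OPTIONS --safe #-}

-- Multiplication by a homogeneous unit g of degree -1 whose inverse is
-- homogeneous of degree 1 carries degree r bijectively onto degree r - 1, so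
-- every graded algebra with such a unit is the Laurent polynomial algebra over
-- its degree 0 part.  For g = x - 2 the constant term is invertible because
-- 2 ≠ 0, membership in 𝓕₋₁ reads x/(x - 1) - 2 = (x - 2)/(1 - x), and applying
-- the substitution to g * g⁻¹ = 1 puts g⁻¹ into 𝓕₁.
module Submission where

open import Defs
open import Algebra.Apartness.Bundles using (HeytingField)
open import Algebra.Bundles using (CommutativeRing)
open import Algebra.Definitions using (Invertible)
import Algebra.Properties.CommutativeSemigroup as CommutativeSemigroupProperties
import Algebra.Properties.Ring as RingProperties
open import Data.Integer.Base as ℤ using (ℤ; +_; -[1+_]; 0ℤ; 1ℤ; -_; -1ℤ)
import Data.Integer.Properties as ℤ
open import Data.Nat.Base as ℕ using (ℕ; zero; suc)
open import Data.Product.Base using (_×_; Σ-syntax; _,_; proj₁; proj₂)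
open import Data.Unit.Polymorphic.Base using (tt)
open import Function.Base using (id)
open import Function.Bundles using (mk⇔)
open import Relation.Binary.PropositionalEquality.Core as ≡ using (_≡_)
import Relation.Binary.Reasoning.Setoid as SetoidReasoning
open import Relation.Nullary.Decidable.Core using (yes; no)
open import Relation.Nullary.Negation.Core using (contradiction)
open import Relation.Unary using (Pred)

-- Finite sums over symmetric windows of integers.

module WindowProperties {c ℓ a ℓa p} {K : CommutativeRing c ℓ} (A : CommutativeAlgebra K a ℓa)
                        {P : ℤ → Pred (CommutativeAlgebra.Carrier A) p} (G : IsGradedFamily A P) where
  open CommutativeAlgebra A hiding (-_)
  open DirectSum A G using (window)

  window-cong : ∀ N {h k} → (∀ r → h r ≈ k r) → window N h ≈ window N k
  window-cong zero    h≈k = h≈k 0ℤ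
  window-cong (suc N) h≈k = +-cong (window-cong N h≈k) (+-cong (h≈k _) (h≈k _))

  -- Each step of a window adds a pair of opposite indices, so negation only swaps the pair. This is
  -- needed because the term in T^j lands in degree `- j`.
  window-neg : ∀ N h → window N (λ r → h (- r)) ≈ window N h
  window-neg zero    h = refl
  window-neg (suc N) h = +-cong (window-neg N h) (+-comm _ _)

  window-distribʳ : ∀ N h x → window N h * x ≈ window N (λ r → h r * x)
  window-distribʳ zero    h x = refl
  window-distribʳ (suc N) h x =
    trans (distribʳ x _ _) (+-cong (window-distribʳ N h x) (distribʳ x _ _))

-- Graded algebras with a homogeneous unit of degree -1.

module HomogeneousUnit {c ℓ a ℓa p} {K : CommutativeRing c ℓ} (A : CommutativeAlgebra K a ℓa)
                       {P : ℤ → Pred (CommutativeAlgebra.Carrier A) p} (G : IsGradedFamily A P)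
                       (g : CommutativeAlgebra.Carrier A)
                       (inv : Invertible (CommutativeAlgebra._≈_ A) (CommutativeAlgebra.1# A) (CommutativeAlgebra._*_ A) g)
                       (g∈ : P -1ℤ g) (g⁻¹∈ : P 1ℤ (proj₁ inv)) where
  open CommutativeAlgebra A hiding (-_)
  open IsGradedFamily G
  open IntegerPower commutativeRing
  open WindowProperties A G
  open RingProperties ring using (-‿distribˡ-*)
  open CommutativeSemigroupProperties *-commutativeSemigroup using (interchange)
  open SetoidReasoning setoid

  private
    A₀ : CommutativeAlgebra K _ _
    A₀ = ZeroPart.zeroPart A G

    A₀[T,T⁻¹] ⨁A : RawGradedAlgebra (CommutativeRing.Carrier K) _ _
    A₀[T,T⁻¹] = LaurentPolynomials.laurentAlgebra A₀ -1ℤ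
    ⨁A        = DirectSum.gradedAlgebra A G id

    module L = DirectSum A₀ (LaurentPolynomials.allCoefficients A₀)
    module D = DirectSum A G
    open LaurentPolynomials A₀ using (monomial)

    coeff : L.⨁ → ℤ → Carrier
    coeff f j = proj₁ (L.component f j)

  g^ : ℤ → Carrier
  g^ = power g inv

  -- The cases are split until each sum of degrees, such as `-1ℤ` plus `- (+ suc n)`, reduces by
  -- computation; no transport along an equation of integers is then needed.
  g^∈ : ∀ j → P (- j) (g^ j)
  g^∈ (+ zero)        = 1∈
  g^∈ (+ suc zero)    = *∈ g∈ 1∈
  g^∈ (+ suc (suc n)) = *∈ g∈ (g^∈ (+ suc n))
  g^∈ -[1+ zero ]     = *∈ g⁻¹∈ 1∈
  g^∈ -[1+ suc n ]    = *∈ g⁻¹∈ (g^∈ -[1+ n ])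

  g^-inverseˡ : ∀ j → g^ (- j) * g^ j ≈ 1#
  g^-inverseˡ j = trans (sym (power-+ g inv (- j) j)) (reflexive (≡.cong g^ (ℤ.+-inverseˡ j)))

  *g^*g^-cancel : ∀ x j → x * g^ (- j) * g^ j ≈ x
  *g^*g^-cancel x j = trans (*-assoc x _ _) (trans (*-congˡ (g^-inverseˡ j)) (*-identityʳ x))

  *g^-cancelʳ : ∀ j {x y} → x * g^ j ≈ y * g^ j → x ≈ y
  *g^-cancelʳ j {x} {y} xg≈yg = begin
    x                       ≈⟨ cancel x ⟨
    x * g^ j * g^ (- j)     ≈⟨ *-congʳ xg≈yg ⟩
    y * g^ j * g^ (- j)     ≈⟨ cancel y ⟩
    y                       ∎
    where
    cancel : ∀ z → z * g^ j * g^ (- j) ≈ z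
    cancel z = trans (*-congʳ (*-congˡ (reflexive (≡.cong g^ (≡.sym (ℤ.neg-involutive j))))))
      (*g^*g^-cancel z (- j))

  -- The substitution of `g` for T. As T has degree -1, the component in degree `r` comes from the
  -- coefficient of T^(-r) alone.
  evaluate : L.⨁ → D.⨁
  evaluate f = record
    { component = λ r → coeff f (- r) * g^ (- r)
    ; member    = λ r → ≡.subst (λ s → P s (coeff f (- r) * g^ (- r)))
        (≡.trans (ℤ.+-identityˡ _) (ℤ.neg-involutive r))
        (*∈ (proj₂ (L.component f (- r))) (g^∈ (- r)))
    ; bound     = L.bound f
    ; vanish    = λ r b<r → trans
        (*-congʳ (L.vanish f (- r) (≡.subst (L.bound f ℕ.<_) (≡.sym (ℤ.∣-i∣≡∣i∣ r)) b<r)))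
        (zeroˡ _)
    }

  evaluate-monomial : ∀ ρ j (m : P (- j) (proj₁ ρ * g^ j)) →
                      evaluate (monomial ρ j) D.≋ D.single (- j) (proj₁ ρ * g^ j) m
  -- The two sides test `- r` against `j` and `r` against `- j`. Negation is an involution, so the
  -- mixed outcomes are contradictory.
  evaluate-monomial ρ j m r with - r ℤ.≟ j | r ℤ.≟ - j
  ... | yes ≡.refl | yes _   = refl
  ... | yes ≡.refl | no r≢   = contradiction (≡.sym (ℤ.neg-involutive r)) r≢
  ... | no -r≢j    | yes r≡  = contradiction (≡.trans (≡.cong -_ r≡) (ℤ.neg-involutive j)) -r≢j
  ... | no _       | no _    = zeroˡ _

  single-cong : ∀ r {x y} x∈ y∈ → x ≈ y → D.single r x x∈ D.≋ D.single r y y∈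
  single-cong r _ _ x≈y s with s ℤ.≟ r
  ... | yes _ = x≈y
  ... | no _  = refl

  -- Covers both 0 and 1, which are each a `single` in degree 0; the factor `g^ 0ℤ` is `1#`.
  evaluate-constant : ∀ ρ m → evaluate (monomial ρ 0ℤ) D.≋ D.single 0ℤ (proj₁ ρ) m
  evaluate-constant ρ m r = trans
    (evaluate-monomial ρ 0ℤ (resp (sym (*-identityʳ _)) m) r)
    (single-cong 0ℤ (resp (sym (*-identityʳ _)) m) m (*-identityʳ _) r)

  coeff-window : ∀ N h → proj₁ (L.window N h) ≡ D.window N (λ r → proj₁ (h r))
  coeff-window zero    h = ≡.refl
  coeff-window (suc N) h = ≡.cong (_+ (proj₁ (h (+ suc N)) + proj₁ (h -[1+ N ]))) (coeff-window N h)

  -- Both convolutions run over the same window, since `evaluate` keeps `bound`. Once one of them is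
  -- reindexed by negation they agree term by term, because the exponents `- r` and `- (t - r)` add
  -- up to `- t`.
  evaluate-* : ∀ f h → evaluate (f L.⊗ h) D.≋ (evaluate f D.⊗ evaluate h)
  evaluate-* f h t = begin
    coeff (f L.⊗ h) (- t) * g^ (- t)
      ≡⟨ ≡.cong (_* g^ (- t)) (coeff-window N _) ⟩
    D.window N (λ r → coeff f r * coeff h (- t ℤ.- r)) * g^ (- t)
      ≈⟨ window-distribʳ N _ _ ⟩
    D.window N (λ r → coeff f r * coeff h (- t ℤ.- r) * g^ (- t))
      ≈⟨ window-neg N _ ⟨
    D.window N (λ r → coeff f (- r) * coeff h (- t ℤ.- - r) * g^ (- t))
      ≈⟨ window-cong N summand ⟩
    D.window N (λ r → (coeff f (- r) * g^ (- r)) * (coeff h (- (t ℤ.- r)) * g^ (- (t ℤ.- r)))) ∎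
    where
    N : ℕ
    N = L.bound f

    -t≡ : ∀ r → - r ℤ.+ - (t ℤ.- r) ≡ - t
    -t≡ r = ≡.trans (≡.sym (ℤ.neg-distrib-+ r (t ℤ.- r))) (≡.cong -_
      (≡.trans (ℤ.+-comm r _) (≡.trans (ℤ.+-assoc t (- r) r)
        (≡.trans (≡.cong (λ s → t ℤ.+ s) (ℤ.+-inverseˡ r)) (ℤ.+-identityʳ t)))))

    summand : ∀ r → coeff f (- r) * coeff h (- t ℤ.- - r) * g^ (- t) ≈
                    (coeff f (- r) * g^ (- r)) * (coeff h (- (t ℤ.- r)) * g^ (- (t ℤ.- r)))
    summand r = begin
      coeff f (- r) * coeff h (- t ℤ.- - r) * g^ (- t)
        ≡⟨ ≡.cong₂ (λ i j → coeff f (- r) * coeff h i * g^ j)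
             (≡.sym (ℤ.neg-distrib-+ t (- r))) (≡.sym (-t≡ r)) ⟩
      coeff f (- r) * coeff h (- (t ℤ.- r)) * g^ (- r ℤ.+ - (t ℤ.- r))
        ≈⟨ *-congˡ (power-+ g inv (- r) (- (t ℤ.- r))) ⟩
      coeff f (- r) * coeff h (- (t ℤ.- r)) * (g^ (- r) * g^ (- (t ℤ.- r)))
        ≈⟨ interchange _ _ _ _ ⟩
      (coeff f (- r) * g^ (- r)) * (coeff h (- (t ℤ.- r)) * g^ (- (t ℤ.- r))) ∎

  -- The inverse of `evaluate`: multiplying the component of degree `- j` by `g^ (- j)`, which has
  -- degree `j`, brings it into degree 0.
  expand : D.⨁ → L.⨁
  expand F = record
    { component = λ j → D.component F (- j) * g^ (- j)
                      , ≡.subst (λ s → P s (D.component F (- j) * g^ (- j))) (ℤ.+-inverseʳ (- j))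
                          (*∈ (D.member F (- j)) (g^∈ (- j)))
    ; member    = λ _ → tt
    ; bound     = D.bound F
    ; vanish    = λ j b<j → trans
        (*-congʳ (D.vanish F (- j) (≡.subst (D.bound F ℕ.<_) (≡.sym (ℤ.∣-i∣≡∣i∣ j)) b<j)))
        (zeroˡ _)
    }

  evaluate-expand : ∀ F → evaluate (expand F) D.≋ F
  evaluate-expand F r = trans (*g^*g^-cancel _ (- r))
    (reflexive (≡.cong (D.component F) (ℤ.neg-involutive r)))

  evaluate-cong : ∀ {f h} → f L.≋ h → evaluate f D.≋ evaluate h
  evaluate-cong f≋h r = *-congʳ (f≋h (- r))

  private
    -- Reads the coefficient of T^j off a component. The double negation does not reduce for a
    -- variable `j`, so an explicit equation is required.
    at-neg : ∀ f j → D.component (evaluate f) (- j) ≡ coeff f j * g^ j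
    at-neg f j = ≡.cong (λ i → coeff f i * g^ i) (ℤ.neg-involutive j)

    -1*-i≡i : ∀ i → -1ℤ ℤ.* - i ≡ i
    -1*-i≡i i = ≡.trans (ℤ.-1*i≡-i (- i)) (ℤ.neg-involutive i)

  evaluate-injective : ∀ {f h} → evaluate f D.≋ evaluate h → f L.≋ h
  evaluate-injective {f} {h} e j = *g^-cancelʳ j (begin
    coeff f j * g^ j                  ≡⟨ at-neg f j ⟨
    D.component (evaluate f) (- j)    ≈⟨ e (- j) ⟩
    D.component (evaluate h) (- j)    ≡⟨ at-neg h j ⟩
    coeff h j * g^ j                  ∎)

  evaluate-isGradedAlgebraIsomorphism : IsGradedAlgebraIsomorphism A₀[T,T⁻¹] ⨁A evaluate
  evaluate-isGradedAlgebraIsomorphism = record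
    { isRingIsomorphism = record
      { isRingMonomorphism = record
        { isRingHomomorphism = record
          { isSemiringHomomorphism = record
            { isNearSemiringHomomorphism = record
              { +-isMonoidHomomorphism = record
                { isMagmaHomomorphism = record
                  { isRelHomomorphism = record { cong = λ {f} {h} → evaluate-cong {f} {h} }
                  ; homo = λ f h r → distribʳ _ _ _
                  }
                ; ε-homo = evaluate-constant (0# , 0∈) 0∈
                }
              ; *-homo = evaluate-*
              }
            ; 1#-homo = evaluate-constant (1# , 1∈) 1∈
            }
          ; -‿homo = λ f r → sym (-‿distribˡ-* _ _)
          }
        ; injective = λ {f} {h} → evaluate-injective {f} {h}
        }
      ; surjective = λ F → expand F , λ {f} f≋ r →
          trans (evaluate-cong {f} {expand F} f≋ r) (evaluate-expand F r)
      }
    ; •-homo      = λ k f r → •-*-assoc k _ _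
    -- A component is a coefficient times a power of the unit `g`, so one vanishes exactly when the
    -- other does; the degree of T^(-r) is `-1ℤ * - r`, that is `r`.
    ; homogeneous = λ d f → mk⇔
        (λ hom r r≢d → trans
          (*-congʳ (hom (- r) (λ e → r≢d (≡.trans (≡.sym (-1*-i≡i r)) e))))
          (zeroˡ _))
        (λ hom j -j≢d → *g^-cancelʳ j (begin
          coeff f j * g^ j                  ≡⟨ at-neg f j ⟨
          D.component (evaluate f) (- j)    ≈⟨ hom (- j) (λ e → -j≢d (≡.trans (ℤ.-1*i≡-i j) e)) ⟩
          0#                                ≈⟨ zeroˡ _ ⟨
          0# * g^ j                         ∎))
    }

  monomial∈ : ∀ (ρ : CommutativeAlgebra.Carrier A₀) j → P (- j) (proj₁ ρ * g^ j)
  monomial∈ ρ j = ≡.subst (λ s → P s (proj₁ ρ * g^ j)) (ℤ.+-identityˡ (- j))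
    (*∈ (proj₂ ρ) (g^∈ j))

-- The rational function identity behind x - 2.

module _ {a ℓ} (R : CommutativeRing a ℓ) where
  open CommutativeRing R renaming (-_ to ⊝_)
  open RingProperties ring using (-‿distribˡ-*; -‿distribʳ-*; -‿+-comm)
  open CommutativeSemigroupProperties +-commutativeSemigroup using (interchange; x∙yz≈y∙xz)
  open SetoidReasoning setoid

  -- Here `y` is 1/(1 - x) and `⊝ y` is 1/(x - 1). With z = xy the hypothesis becomes y = 1 + z, so
  -- y(x - 2) = z - 2(1 + z) = -2 - z.
  [x-2]/[1-x] : ∀ x y → (1# - x) * y ≈ 1# → y * (x - (1# + 1#)) ≈ ⊝ (1# + 1#) + x * ⊝ y
  [x-2]/[1-x] x y [1-x]y≈1 = begin
    y * (x - (1# + 1#))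
      ≈⟨ distribˡ y x _ ⟩
    y * x + y * ⊝ (1# + 1#)
      ≈⟨ +-cong (*-comm y x) (sym (-‿distribʳ-* y _)) ⟩
    z - y * (1# + 1#)
      ≈⟨ +-congˡ (-‿cong (trans (distribˡ y 1# 1#) (+-cong y1≈1+z y1≈1+z))) ⟩
    z - ((1# + z) + (1# + z))
      ≈⟨ +-congˡ (-‿cong (interchange 1# z 1# z)) ⟩
    z - ((1# + 1#) + (z + z))
      ≈⟨ +-congˡ (-‿+-comm _ _) ⟨
    z + (⊝ (1# + 1#) - (z + z))
      ≈⟨ x∙yz≈y∙xz z _ _ ⟩
    ⊝ (1# + 1#) + (z - (z + z))
      ≈⟨ +-congˡ (+-congˡ (-‿+-comm z z)) ⟨
    ⊝ (1# + 1#) + (z + (⊝ z - z))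
      ≈⟨ +-congˡ (trans (sym (+-assoc z _ _)) (trans (+-congʳ (-‿inverseʳ z)) (+-identityˡ _))) ⟩
    ⊝ (1# + 1#) - z
      ≈⟨ +-congˡ (-‿distribʳ-* x y) ⟩
    ⊝ (1# + 1#) + x * ⊝ y ∎
    where
    z : Carrier
    z = x * y

    y1≈1+z : y * 1# ≈ 1# + z
    y1≈1+z = begin
      y * 1#                ≈⟨ trans (*-identityʳ y) (sym (*-identityˡ y)) ⟩
      1# * y                ≈⟨ trans (+-congˡ (-‿inverseˡ z)) (+-identityʳ _) ⟨
      1# * y + (⊝ z + z)    ≈⟨ +-assoc _ _ _ ⟨
      1# * y - z + z        ≈⟨ +-congʳ (trans (distribʳ y 1# _) (+-congˡ (sym (-‿distribˡ-* x y)))) ⟨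
      (1# - x) * y + z      ≈⟨ +-congʳ [1-x]y≈1 ⟩
      1# + z                ∎

-- The series x - 2: invertibility, and the degrees of it and its inverse.

module _ {c ℓ} (K : CommutativeRing c ℓ) where
  private
    module K = CommutativeRing K
    module KP = RingProperties K.ring
  open PowerSeries K
  open GradedSeries K
  open CommutativeRing K[[x]] renaming (-_ to ⊝_)
  open IntegerPower K[[x]]

  X-constant-invertible : ∀ k → Invertible K._≈_ K.1# K._*_ k → Invertible _≈_ 1# _*_ (X - constant k)
  X-constant-invertible k (k⁻¹ , _ , kk⁻¹≈1) = v , trans (*-comm v (X - constant k)) inverse , inverse
    where
    -- The geometric expansion of 1/(x - k), whose coefficient at x^n is -1/k^(n+1).
    v : Series
    v zero    = K.- k⁻¹
    v (suc n) = k⁻¹ K.* v n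

    tailX : tail X ≈ 1#
    tailX zero    = K.refl
    tailX (suc _) = K.refl

    coefficients : X * v - k •̇ v ≈ 1#
    coefficients zero = begin
      (X * v) 0 K.- k K.* K.- k⁻¹    ≈⟨ K.+-cong (Substitution.σ⊛-zero X K.refl v) (K.-‿cong (K.sym (KP.-‿distribʳ-* k k⁻¹))) ⟩
      K.0# K.- K.- (k K.* k⁻¹)       ≈⟨ K.trans (K.+-identityˡ _) (KP.-‿involutive _) ⟩
      k K.* k⁻¹                      ≈⟨ kk⁻¹≈1 ⟩
      K.1#                           ∎
      where open SetoidReasoning K.setoid
    coefficients (suc n) = begin
      (X * v) (suc n) K.- k K.* (k⁻¹ K.* v n)
        ≈⟨ K.+-cong (K.trans (Substitution.σ⊛-suc X K.refl v n)
             (K.trans (*-congʳ {v} tailX n) (*-identityˡ v n)))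
             (K.-‿cong (K.trans (K.sym (K.*-assoc k k⁻¹ (v n)))
               (K.trans (K.*-congʳ kk⁻¹≈1) (K.*-identityˡ _)))) ⟩
      v n K.- v n
        ≈⟨ K.-‿inverseʳ _ ⟩
      K.0# ∎
      where open SetoidReasoning K.setoid

    inverse : (X - constant k) * v ≈ 1#
    inverse = begin
      (X - constant k) * v           ≈⟨ distribʳ v X (⊝ constant k) ⟩
      X * v + ⊝ constant k * v       ≈⟨ +-congˡ {X * v} (RingProperties.-‿distribˡ-* ring (constant k) v) ⟨
      X * v - constant k * v         ≈⟨ +-congˡ {X * v} (-‿cong (constant-⊛ k v)) ⟩
      X * v - k •̇ v                  ≈⟨ coefficients ⟩
      1#                             ∎
      where open SetoidReasoning setoid

  g₋₁∈𝓕₋₁ : 𝓕⟨ -1ℤ ⟩ g₋₁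
  g₋₁∈𝓕₋₁ = begin
    g₋₁ ⟨ x/[x-1] ⟩
      -- One unfolding computes the substitution, since the tail of x - 2 is the constant series 1.
      ≈⟨ ⟨σ⟩-unfold g₋₁ ⟩
    constant (g₋₁ 0) + x/[x-1] * (tail g₋₁ ⟨ x/[x-1] ⟩)
      ≈⟨ +-cong g₋₁0≈-2 (*-congˡ {x/[x-1]} (trans (⟨σ⟩-cong tail-g₋₁) ⟨σ⟩-1)) ⟩
    ⊝ (1# + 1#) + x/[x-1] * 1#
      ≈⟨ +-congˡ {⊝ (1# + 1#)} (*-identityʳ x/[x-1]) ⟩
    ⊝ (1# + 1#) + x/[x-1]
      ≈⟨ [x-2]/[1-x] K[[x]] X geometric [1-x]*geometric ⟨
    geometric * (X - (1# + 1#))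
      -- `power` at `-1ℤ` computes to `geometric ^ 1`, hence the trailing factor `1#`.
      ≈⟨ *-cong (*-identityʳ geometric) (+-congˡ {X} (-‿cong constant-2)) ⟨
    geometric * 1# * g₋₁ ∎
    where
    open SetoidReasoning setoid
    open Substitution x/[x-1] x/[x-1]-constantTerm

    constant-2 : constant (K.1# K.+ K.1#) ≈ 1# + 1#
    constant-2 zero    = K.refl
    constant-2 (suc n) = K.sym (K.+-identityˡ _)

    g₋₁0≈-2 : constant (g₋₁ 0) ≈ ⊝ (1# + 1#)
    g₋₁0≈-2 zero    = K.+-identityˡ _
    g₋₁0≈-2 (suc n) = K.sym (K.trans (K.-‿cong (K.+-identityˡ _)) KP.-0#≈0#)

    tail-g₋₁ : tail g₋₁ ≈ 1#
    tail-g₋₁ zero    = K.trans (K.+-congˡ KP.-0#≈0#) (K.+-identityʳ _)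
    tail-g₋₁ (suc n) = K.trans (K.+-congˡ KP.-0#≈0#) (K.+-identityʳ _)

  -- Substitution is multiplicative, so `ψσ` is an inverse of the substituted `φ`, which equals
  -- `u r * φ`. The series `u (- r) * ψ` is another inverse of it, and inverses are unique.
  𝓕-inverse : ∀ r φ (inv : Invertible _≈_ 1# _*_ φ) → 𝓕⟨ r ⟩ φ → 𝓕⟨ - r ⟩ (proj₁ inv)
  𝓕-inverse r φ (ψ , _ , φψ≈1) φ∈ = begin
    ψσ                                      ≈⟨ *-identityˡ ψσ ⟨
    1# * ψσ                                 ≈⟨ *-congʳ {ψσ} u⁻ʳuʳφψ≈1 ⟨
    (u (- r) * ψ) * (u r * φ) * ψσ          ≈⟨ *-assoc (u (- r) * ψ) (u r * φ) ψσ ⟩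
    (u (- r) * ψ) * ((u r * φ) * ψσ)        ≈⟨ *-congˡ {u (- r) * ψ} φσψσ≈1 ⟩
    (u (- r) * ψ) * 1#                      ≈⟨ *-identityʳ (u (- r) * ψ) ⟩
    u (- r) * ψ                             ∎
    where
    open SetoidReasoning setoid
    open Substitution x/[x-1] x/[x-1]-constantTerm
    open CommutativeSemigroupProperties *-commutativeSemigroup using (interchange)

    u : ℤ → Series
    u = power (1# - X) 1-x-invertible

    ψσ : Series
    ψσ = ψ ⟨ x/[x-1] ⟩

    u⁻ʳuʳφψ≈1 : (u (- r) * ψ) * (u r * φ) ≈ 1#
    u⁻ʳuʳφψ≈1 = begin
      (u (- r) * ψ) * (u r * φ)    ≈⟨ interchange (u (- r)) ψ (u r) φ ⟩
      (u (- r) * u r) * (ψ * φ)    ≈⟨ *-cong (power-+ (1# - X) 1-x-invertible (- r) r) (*-comm φ ψ) ⟨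
      u (- r ℤ.+ r) * (φ * ψ)      ≡⟨ ≡.cong (λ s → u s * (φ * ψ)) (ℤ.+-inverseˡ r) ⟩
      1# * (φ * ψ)                 ≈⟨ *-identityˡ (φ * ψ) ⟩
      φ * ψ                        ≈⟨ φψ≈1 ⟩
      1#                           ∎

    φσψσ≈1 : (u r * φ) * ψσ ≈ 1#
    φσψσ≈1 = begin
      (u r * φ) * ψσ               ≈⟨ *-congʳ {ψσ} φ∈ ⟨
      (φ ⟨ x/[x-1] ⟩) * ψσ         ≈⟨ ⟨σ⟩-⊛ φ ψ ⟨
      (φ * ψ) ⟨ x/[x-1] ⟩          ≈⟨ ⟨σ⟩-cong φψ≈1 ⟩
      1# ⟨ x/[x-1] ⟩               ≈⟨ ⟨σ⟩-1 ⟩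
      1#                           ∎

-- Invertibility of 2 and the case of power series.

2-invertible : ∀ {c ℓ₁ ℓ₂} (K : HeytingField c ℓ₁ ℓ₂) → CharacteristicZero K →
               let open HeytingField K in Invertible _≈_ 1# _*_ (1# + 1#)
-- `char0 1` concerns the multiple 2, as the index is shifted by one. Apartness from 0 makes the
-- difference with 0 invertible, and `2≈` simplifies that difference to `1# + 1#`.
2-invertible K char0 = let h , hk , kh = #⇒invertible (char0 1) in
  h , trans (*-congˡ (sym 2≈)) hk , trans (*-congʳ (sym 2≈)) kh
  where
  open HeytingField K
  2≈ : (1# + (1# + 0#)) - 0# ≈ 1# + 1#
  2≈ = trans (+-cong (+-congˡ (+-identityʳ 1#)) (RingProperties.-0#≈0# (CommutativeRing.ring (baseRing K))))
    (+-identityʳ _)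

theorem3p4 : ∀ {c ℓ₁ ℓ₂} (K : HeytingField c ℓ₁ ℓ₂) → CharacteristicZero K →
    let open PowerSeries (baseRing K)
        open GradedSeries (baseRing K)
        open IntegerPower K[[x]]
        module S = CommutativeRing K[[x]]
        module L = RawGradedAlgebra 𝓕₀[T,T⁻¹]
        module F = RawGradedAlgebra 𝓕
    in 𝓕⟨ -1ℤ ⟩ g₋₁
       × Σ[ g₋₁-inv ∈ Invertible S._≈_ S.1# S._*_ g₋₁ ]
         Σ[ Φ ∈ (L.Carrier → F.Carrier) ]
           IsGradedAlgebraIsomorphism 𝓕₀[T,T⁻¹] 𝓕 Φ
           × (∀ ρ j → Σ[ m ∈ 𝓕⟨ - j ⟩ (proj₁ ρ S.* power g₋₁ g₋₁-inv j) ]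
                Φ (ρ T^ j) F.≈ inDegree (- j) (proj₁ ρ S.* power g₋₁ g₋₁-inv j) m)
theorem3p4 K char0 =
  g₋₁∈𝓕₋₁ R , g₋₁-inv , evaluate , evaluate-isGradedAlgebraIsomorphism ,
  λ ρ j → monomial∈ ρ j , evaluate-monomial ρ j (monomial∈ ρ j)
  where
  R = baseRing K
  open PowerSeries R using (seriesAlgebra)
  open GradedSeries R using (𝓕-isGradedFamily; g₋₁)
  g₋₁-inv = X-constant-invertible R _ (2-invertible K char0)
  -- The inverse is placed in degree `- -1ℤ`, which computes to `1ℤ`.
  open HomogeneousUnit seriesAlgebra 𝓕-isGradedFamily g₋₁ g₋₁-inv
    (g₋₁∈𝓕₋₁ R) (𝓕-inverse R -1ℤ g₋₁ g₋₁-inv (g₋₁∈𝓕₋₁ R))
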